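{- Define the integer sequence $(r_n)_{n\ge 0}$ by $r_0=4$, $r_1=16$ and $r_{n+1}=8r_n-r_{n-1}$ for $n\ge 1$. Let $r\ge 5$ be an integer. The triangle associated with the $D(4)$-triple $\{r-2,r+2,4r\}$, which has side lengths $(r,2r-2,2r+2)$, is Heronian if and only if $r=r_n$ for some $n\ge 1$.
   Context: A $D(4)$-triple is a set of three distinct positive integers such that the product of any two distinct elements, increased by $4$, is a perfect square. The triangle associated with a $D(4)$-triple $\{a,b,c\}$, $a<b<c$, is the triangle with side lengths $\sqrt{ab+4}$, $\sqrt{ac+4}$, $\sqrt{bc+4}$, provided these form a non-degenerate triangle; for $\{r-2,r+2,4r\}$ with $r\ge5$ these lengths are $r$, $2r-2$, $2r+2$ and the triangle is non-degenerate. A Heronian triangle is a triangle with integer side lengths whose area is also an integer. -}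

module Defs where

open import Data.Integer using (ℤ; +_; _+_; _*_; _-_; -_; _≤_; _<_)
open import Data.Nat using (ℕ; zero; suc)
open import Data.Product using (∃-syntax; _×_)
open import Relation.Binary.PropositionalEquality using (_≡_; _≢_)

IsSquare : ℤ → Set
IsSquare m = ∃[ k ] m ≡ k * k

record IsD4Triple (a b c : ℤ) : Set where
  field
    a>0 : + 0 < a
    b>0 : + 0 < b
    c>0 : + 0 < c
    a≢b : a ≢ b
    a≢c : a ≢ c
    b≢c : b ≢ c
    ab  : IsSquare (a * b + + 4)
    ac  : IsSquare (a * c + + 4)
    bc  : IsSquare (b * c + + 4)

record IsTriangle (x y z : ℤ) : Set where
  field
    x>0   : + 0 < x
    y>0   : + 0 < y
    z>0   : + 0 < z
    x<y+z : x < y + z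
    y<x+z : y < x + z
    z<x+y : z < x + y

-- s = √m, the nonnegative root.
IsSqrt : ℤ → ℤ → Set
IsSqrt s m = + 0 ≤ s × s * s ≡ m

-- x, y, z are the side lengths of the triangle associated with {a, b, c}.
-- Integer side lengths lose no generality: in a D(4)-triple the three
-- radicands are perfect squares.
record AssociatedTriangle (a b c x y z : ℤ) : Set where
  field
    triple   : IsD4Triple a b c
    a<b      : a < b
    b<c      : b < c
    x≡√      : IsSqrt x (a * b + + 4)
    y≡√      : IsSqrt y (a * c + + 4)
    z≡√      : IsSqrt z (b * c + + 4)
    triangle : IsTriangle x y z

-- Area of the triangle with side lengths x, y, z, by Heron's formula
-- A = √(s(s-x)(s-y)(s-z)), s = (x+y+z)/2, with denominators cleared.
HasArea : ℤ → ℤ → ℤ → ℤ → Set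
HasArea x y z A =
  IsSqrt (+ 4 * A) ((x + y + z) * (- x + y + z) * (x - y + z) * (x + y - z))

IsHeronian : ℤ → ℤ → ℤ → Set
IsHeronian x y z = IsTriangle x y z × ∃[ A ] HasArea x y z A

rSeq : ℕ → ℤ
rSeq zero          = + 4
rSeq (suc zero)    = + 16
rSeq (suc (suc n)) = + 8 * rSeq (suc n) - rSeq n

{-# OPTIONS --safe #-}

-- Heron's formula gives 16 A² = 15 r² (r² − 16), so the triangle is Heronian
-- iff 15 (r² − 16) = w² for some w (and then A = r w / 4).  The unit
-- 4 + √15 acts on the solutions of w² + 240 = 15 r² by
-- (r, w) ↦ (4r + w, 15r + 4w).  Its inverse maps a solution with r ≥ 16 to one
-- with smaller w, and the only solution with r < 16 is (4, 0).  Hence the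
-- solutions are r = 4u, w = 60v, where u + v√15 = (4 + √15)ⁿ.
module Submission where

open import Defs
open import Data.Integer using (ℤ; +_; +<+; +≤+; _+_; _*_; _-_; -_; _≤_; _<_; ∣_∣)
import Data.Integer.Properties as ℤ
open import Algebra.Properties.AbelianGroup ℤ.+-0-abelianGroup using ()
  renaming (∙-cancelʳ to +-cancelʳ)
import Data.Integer.Tactic.RingSolver as ℤ-Ring
open import Data.Nat as ℕ using (ℕ; zero; suc; z≤n; s≤s; z<s)
open import Data.Nat.Coprimality using (coprime-divisor; coprime-/gcd)
open import Data.Nat.Divisibility
  using (_∣_; divides; quotient; ∣-refl; ∣-trans; m∣m*n; n∣m*n; ∣m+n∣m⇒∣n; *-cancelʳ-∣)
open import Data.Nat.DivMod using (_/_; m/n*n≡m)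
open import Data.Nat.GCD using (gcd; gcd[m,n]∣m; gcd[m,n]∣n; gcd[m,n]≢0)
open import Data.Nat.Induction using (<-rec)
import Data.Nat.Properties as ℕ
import Data.Nat.Tactic.RingSolver as ℕ-Ring
open import Data.Product using (∃-syntax; _×_; _,_)
open import Data.Sum using (inj₁)
open import Function.Bundles using (_⇔_; mk⇔; Equivalence)
open import Relation.Binary.PropositionalEquality
  using (_≡_; refl; sym; trans; cong; cong₂; subst; subst₂; module ≡-Reasoning)
open import Relation.Nullary using (yes; no; contradiction)
open import Relation.Nullary.Decidable using (from-yes; _×-dec_; _→-dec_)

-- Divisibility between squares

-- After dividing by d = gcd m n, the quotients a and b are coprime and a² divides b². Coprimality
-- gives a ∣ b, so a = 1 and m = d, which divides n.
m²∣n²⇒m∣n : ∀ m n .{{_ : ℕ.NonZero m}} → m ℕ.* m ∣ n ℕ.* n → m ∣ n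
m²∣n²⇒m∣n m n m²∣n² = subst (_∣ n) d≡m (gcd[m,n]∣n m n)
  where
  d = gcd m n
  instance
    d≢0 : ℕ.NonZero d
    d≢0 = ℕ.≢-nonZero (gcd[m,n]≢0 m n (inj₁ (ℕ.≢-nonZero⁻¹ m)))
    d²≢0 : ℕ.NonZero (d ℕ.* d)
    d²≢0 = ℕ.m*n≢0 d d
  a = m / d
  b = n / d
  ad≡m : a ℕ.* d ≡ m
  ad≡m = m/n*n≡m (gcd[m,n]∣m m n)
  bd≡n : b ℕ.* d ≡ n
  bd≡n = m/n*n≡m (gcd[m,n]∣n m n)
  square-* : ∀ x y → (x ℕ.* y) ℕ.* (x ℕ.* y) ≡ (x ℕ.* x) ℕ.* (y ℕ.* y)
  square-* = ℕ-Ring.solve-∀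
  a²∣b² : a ℕ.* a ∣ b ℕ.* b
  a²∣b² = *-cancelʳ-∣ (d ℕ.* d)
    (subst₂ _∣_ (trans (sym (cong₂ ℕ._*_ ad≡m ad≡m)) (square-* a d))
                (trans (sym (cong₂ ℕ._*_ bd≡n bd≡n)) (square-* b d)) m²∣n²)
  a∣b : a ∣ b
  a∣b = coprime-divisor (coprime-/gcd m n) (∣-trans (m∣m*n a) a²∣b²)
  d≡m : d ≡ m
  d≡m = trans (sym (ℕ.*-identityˡ d))
    (trans (cong (ℕ._* d) (sym (coprime-/gcd m n (∣-refl , a∣b)))) ad≡m)

-- Powers of the unit 4 + √15

pellU pellV : ℕ → ℕ
pellU zero    = 1
pellU (suc n) = 4 ℕ.* pellU n ℕ.+ 15 ℕ.* pellV n
pellV zero    = 0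
pellV (suc n) = pellU n ℕ.+ 4 ℕ.* pellV n

-- The unit has norm 16 - 15 = 1, so u² - 15 v² is preserved: in one step u² and 15 v² both grow by
-- `rest`.
pell-equation : ∀ n → pellU n ℕ.* pellU n ≡ 1 ℕ.+ 15 ℕ.* (pellV n ℕ.* pellV n)
pell-equation zero    = refl
pell-equation (suc n) = begin
  U ℕ.* U                                          ≡⟨ expandU u v ⟩
  u ℕ.* u ℕ.+ rest                                 ≡⟨ cong (ℕ._+ rest) (pell-equation n) ⟩
  1 ℕ.+ 15 ℕ.* (v ℕ.* v) ℕ.+ rest                  ≡⟨ expandV u v ⟩
  1 ℕ.+ 15 ℕ.* (V ℕ.* V)                           ∎
  where
  open ≡-Reasoning
  u = pellU n
  v = pellV n
  U = pellU (suc n)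
  V = pellV (suc n)
  rest = 15 ℕ.* (u ℕ.* u ℕ.+ 8 ℕ.* (u ℕ.* v) ℕ.+ 15 ℕ.* (v ℕ.* v))
  expandU : ∀ u v → (4 ℕ.* u ℕ.+ 15 ℕ.* v) ℕ.* (4 ℕ.* u ℕ.+ 15 ℕ.* v) ≡
    u ℕ.* u ℕ.+ 15 ℕ.* (u ℕ.* u ℕ.+ 8 ℕ.* (u ℕ.* v) ℕ.+ 15 ℕ.* (v ℕ.* v))
  expandU = ℕ-Ring.solve-∀
  expandV : ∀ u v →
    1 ℕ.+ 15 ℕ.* (v ℕ.* v) ℕ.+ 15 ℕ.* (u ℕ.* u ℕ.+ 8 ℕ.* (u ℕ.* v) ℕ.+ 15 ℕ.* (v ℕ.* v)) ≡
    1 ℕ.+ 15 ℕ.* ((u ℕ.+ 4 ℕ.* v) ℕ.* (u ℕ.+ 4 ℕ.* v))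
  expandV = ℕ-Ring.solve-∀

-- 4 + √15 is a root of x² = 8x - 1, so `pellU` obeys the recurrence of `rSeq`; `recurrence` states
-- it with the subtracted term moved to the other side.
rSeq≡4pellU : ∀ n → rSeq n ≡ + (4 ℕ.* pellU n)
rSeq≡4pellU zero          = refl
rSeq≡4pellU (suc zero)    = refl
rSeq≡4pellU (suc (suc n)) = begin
  + 8 * rSeq (suc n) - rSeq n  ≡⟨ cong₂ (λ x y → + 8 * x - y) (rSeq≡4pellU (suc n)) (rSeq≡4pellU n) ⟩
  + 8 * + b - + a              ≡⟨ cong (_- + a) (sym (ℤ.pos-* 8 b)) ⟩
  + (8 ℕ.* b) - + a            ≡⟨ cong (λ x → + x - + a) (sym (recurrence (pellU n) (pellV n))) ⟩
  + (c ℕ.+ a) - + a            ≡⟨ cong (_- + a) (ℤ.pos-+ c a) ⟩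
  + c + + a - + a              ≡⟨ add-sub (+ c) (+ a) ⟩
  + c                          ∎
  where
  open ≡-Reasoning
  a = 4 ℕ.* pellU n
  b = 4 ℕ.* pellU (suc n)
  c = 4 ℕ.* pellU (suc (suc n))
  add-sub : ∀ x y → x + y - y ≡ x
  add-sub = ℤ-Ring.solve-∀
  recurrence : ∀ u v →
    4 ℕ.* (4 ℕ.* (4 ℕ.* u ℕ.+ 15 ℕ.* v) ℕ.+ 15 ℕ.* (u ℕ.+ 4 ℕ.* v)) ℕ.+ 4 ℕ.* u ≡
    8 ℕ.* (4 ℕ.* (4 ℕ.* u ℕ.+ 15 ℕ.* v))
  recurrence = ℕ-Ring.solve-∀

-- Descent on the solutions of w² + 240 = 15 r²

PellSolution : ℕ → ℕ → Set
PellSolution r w = w ℕ.* w ℕ.+ 240 ≡ 15 ℕ.* (r ℕ.* r)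

-- Decided by running through all pairs. The bound on `w` loses nothing, since r ≤ 15 gives w² < 15
-- · 15² < 60².
small-solution : ∀ {r} → r ℕ.< 16 → ∀ {w} → w ℕ.< 60 → PellSolution r w → r ≡ 4 × w ≡ 0
small-solution = from-yes
  (ℕ.allUpTo? (λ r → ℕ.allUpTo? (λ w →
    (w ℕ.* w ℕ.+ 240 ℕ.≟ 15 ℕ.* (r ℕ.* r)) →-dec (r ℕ.≟ 4 ×-dec w ℕ.≟ 0)) 60) 16)

-- Makes 4r - w, the first coordinate of the inverse step, a natural number.
w≤4r : ∀ r w → PellSolution r w → w ℕ.≤ 4 ℕ.* r
w≤4r r w eq = ℕ.≮⇒≥ λ 4r<w → ℕ.<-irrefl refl (begin-strict
  15 ℕ.* (r ℕ.* r)             ≤⟨ ℕ.*-monoˡ-≤ (r ℕ.* r) (ℕ.n≤1+n 15) ⟩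
  16 ℕ.* (r ℕ.* r)             ≡⟨ square-4 r ⟩
  (4 ℕ.* r) ℕ.* (4 ℕ.* r)      <⟨ ℕ.*-mono-< 4r<w 4r<w ⟩
  w ℕ.* w                      ≤⟨ ℕ.m≤m+n (w ℕ.* w) 240 ⟩
  w ℕ.* w ℕ.+ 240              ≡⟨ eq ⟩
  15 ℕ.* (r ℕ.* r)             ∎)
  where
  open ℕ.≤-Reasoning
  square-4 : ∀ r → 16 ℕ.* (r ℕ.* r) ≡ (4 ℕ.* r) ℕ.* (4 ℕ.* r)
  square-4 = ℕ-Ring.solve-∀

-- Makes 4w - 15r, the second coordinate of the inverse step, a natural number. By the equation
-- (4w)² = 240 r² - 15 · 16², and r ≥ 16 makes this at least (15r)².
15r≤4w : ∀ r w → 16 ℕ.≤ r → PellSolution r w → 15 ℕ.* r ℕ.≤ 4 ℕ.* w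
15r≤4w r w 16≤r eq = ℕ.≮⇒≥ λ 4w<15r → ℕ.<-irrefl refl (begin-strict
  240 ℕ.* (r ℕ.* r)                            ≡⟨ ℕ.*-assoc 16 15 (r ℕ.* r) ⟩
  16 ℕ.* (15 ℕ.* (r ℕ.* r))                    ≡⟨ cong (16 ℕ.*_) (sym eq) ⟩
  16 ℕ.* (w ℕ.* w ℕ.+ 240)                     ≡⟨ expand w ⟩
  (4 ℕ.* w) ℕ.* (4 ℕ.* w) ℕ.+ 15 ℕ.* 256       <⟨ ℕ.+-mono-<-≤ (ℕ.*-mono-< 4w<15r 4w<15r)
                                                   (ℕ.*-monoʳ-≤ 15 (ℕ.*-mono-≤ 16≤r 16≤r)) ⟩
  (15 ℕ.* r) ℕ.* (15 ℕ.* r) ℕ.+ 15 ℕ.* (r ℕ.* r) ≡⟨ collect r ⟩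
  240 ℕ.* (r ℕ.* r)                            ∎)
  where
  open ℕ.≤-Reasoning
  expand : ∀ w → 16 ℕ.* (w ℕ.* w ℕ.+ 240) ≡ (4 ℕ.* w) ℕ.* (4 ℕ.* w) ℕ.+ 15 ℕ.* 256
  expand = ℕ-Ring.solve-∀
  collect : ∀ r → (15 ℕ.* r) ℕ.* (15 ℕ.* r) ℕ.+ 15 ℕ.* (r ℕ.* r) ≡ 240 ℕ.* (r ℕ.* r)
  collect = ℕ-Ring.solve-∀

-- Multiplication by a unit of norm 1 preserves w² - 15 r²; here `rest` is the common growth of w²
-- and 15 r².
PellSolution-step⁻¹ : ∀ r w → PellSolution (4 ℕ.* r ℕ.+ w) (15 ℕ.* r ℕ.+ 4 ℕ.* w) → PellSolution r w
PellSolution-step⁻¹ r w eq = ℕ.+-cancelˡ-≡ rest _ _ (begin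
  rest ℕ.+ (w ℕ.* w ℕ.+ 240)                             ≡⟨ expandW r w ⟩
  (15 ℕ.* r ℕ.+ 4 ℕ.* w) ℕ.* (15 ℕ.* r ℕ.+ 4 ℕ.* w) ℕ.+ 240 ≡⟨ eq ⟩
  15 ℕ.* ((4 ℕ.* r ℕ.+ w) ℕ.* (4 ℕ.* r ℕ.+ w))           ≡⟨ expandR r w ⟩
  rest ℕ.+ 15 ℕ.* (r ℕ.* r)                              ∎)
  where
  open ≡-Reasoning
  rest = 15 ℕ.* (15 ℕ.* (r ℕ.* r) ℕ.+ 8 ℕ.* (r ℕ.* w) ℕ.+ w ℕ.* w)
  expandW : ∀ r w →
    15 ℕ.* (15 ℕ.* (r ℕ.* r) ℕ.+ 8 ℕ.* (r ℕ.* w) ℕ.+ w ℕ.* w) ℕ.+ (w ℕ.* w ℕ.+ 240) ≡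
    (15 ℕ.* r ℕ.+ 4 ℕ.* w) ℕ.* (15 ℕ.* r ℕ.+ 4 ℕ.* w) ℕ.+ 240
  expandW = ℕ-Ring.solve-∀
  expandR : ∀ r w → 15 ℕ.* ((4 ℕ.* r ℕ.+ w) ℕ.* (4 ℕ.* r ℕ.+ w)) ≡
    15 ℕ.* (15 ℕ.* (r ℕ.* r) ℕ.+ 8 ℕ.* (r ℕ.* w) ℕ.+ w ℕ.* w) ℕ.+ 15 ℕ.* (r ℕ.* r)
  expandR = ℕ-Ring.solve-∀

-- The hypotheses are r′ = 4r - w and w′ = 4w - 15r without subtraction. The step has determinant 4
-- · 4 - 15 = 1, so this is its inverse.
step-inverse : ∀ {r w r′ w′} → w ℕ.+ r′ ≡ 4 ℕ.* r → 15 ℕ.* r ℕ.+ w′ ≡ 4 ℕ.* w →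
  r ≡ 4 ℕ.* r′ ℕ.+ w′ × w ≡ 15 ℕ.* r′ ℕ.+ 4 ℕ.* w′
step-inverse {r} {w} {r′} {w′} w+r′≡4r 15r+w′≡4w = r≡ , w≡
  where
  open ≡-Reasoning
  r≡ : r ≡ 4 ℕ.* r′ ℕ.+ w′
  r≡ = ℕ.+-cancelˡ-≡ (15 ℕ.* r) _ _ (begin
    15 ℕ.* r ℕ.+ r                         ≡⟨ split r ⟩
    4 ℕ.* (4 ℕ.* r)                        ≡⟨ cong (4 ℕ.*_) (sym w+r′≡4r) ⟩
    4 ℕ.* (w ℕ.+ r′)                       ≡⟨ ℕ.*-distribˡ-+ 4 w r′ ⟩
    4 ℕ.* w ℕ.+ 4 ℕ.* r′                   ≡⟨ cong (ℕ._+ 4 ℕ.* r′) (sym 15r+w′≡4w) ⟩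
    15 ℕ.* r ℕ.+ w′ ℕ.+ 4 ℕ.* r′           ≡⟨ swap (15 ℕ.* r) w′ (4 ℕ.* r′) ⟩
    15 ℕ.* r ℕ.+ (4 ℕ.* r′ ℕ.+ w′)         ∎)
    where
    split : ∀ r → 15 ℕ.* r ℕ.+ r ≡ 4 ℕ.* (4 ℕ.* r)
    split = ℕ-Ring.solve-∀
    swap : ∀ x y z → x ℕ.+ y ℕ.+ z ≡ x ℕ.+ (z ℕ.+ y)
    swap = ℕ-Ring.solve-∀
  w≡ : w ≡ 15 ℕ.* r′ ℕ.+ 4 ℕ.* w′
  w≡ = ℕ.+-cancelʳ-≡ r′ _ _ (begin
    w ℕ.+ r′                               ≡⟨ w+r′≡4r ⟩
    4 ℕ.* r                                ≡⟨ cong (4 ℕ.*_) r≡ ⟩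
    4 ℕ.* (4 ℕ.* r′ ℕ.+ w′)                ≡⟨ expand r′ w′ ⟩
    15 ℕ.* r′ ℕ.+ 4 ℕ.* w′ ℕ.+ r′          ∎)
    where
    expand : ∀ x y → 4 ℕ.* (4 ℕ.* x ℕ.+ y) ≡ 15 ℕ.* x ℕ.+ 4 ℕ.* y ℕ.+ x
    expand = ℕ-Ring.solve-∀

predecessor : ∀ r w → 16 ℕ.≤ r → PellSolution r w →
  ∃[ r′ ] ∃[ w′ ] (r ≡ 4 ℕ.* r′ ℕ.+ w′ × w ≡ 15 ℕ.* r′ ℕ.+ 4 ℕ.* w′)
predecessor r w 16≤r eq =
  let r′ , w+r′≡4r   = ℕ.m≤n⇒∃[o]m+o≡n (w≤4r r w eq)
      w′ , 15r+w′≡4w = ℕ.m≤n⇒∃[o]m+o≡n (15r≤4w r w 16≤r eq)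
  in r′ , w′ , step-inverse w+r′≡4r 15r+w′≡4w

-- Strong induction on `w`, which is why `w` comes first. The conclusion also tracks `w`, because
-- the next `r` depends on it.
PellSolution⇒pell : ∀ w r → PellSolution r w → ∃[ n ] (r ≡ 4 ℕ.* pellU n × w ≡ 60 ℕ.* pellV n)
PellSolution⇒pell = <-rec _ descend
  where
  w<w′ : ∀ r w → PellSolution r w → w ℕ.< 15 ℕ.* r ℕ.+ 4 ℕ.* w
  -- r = 0 would give w² + 240 = 0; commuting the sum exposes a successor on the left.
  w<w′ zero    w eq = contradiction (trans (ℕ.+-comm 240 (w ℕ.* w)) eq) λ ()
  w<w′ (suc r) w _  = ℕ.+-mono-≤ {1} {15 ℕ.* suc r} (s≤s z≤n) (ℕ.m≤n*m w 4)
  stepR : ∀ u v → 4 ℕ.* (4 ℕ.* u) ℕ.+ 60 ℕ.* v ≡ 4 ℕ.* (4 ℕ.* u ℕ.+ 15 ℕ.* v)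
  stepR = ℕ-Ring.solve-∀
  stepW : ∀ u v → 15 ℕ.* (4 ℕ.* u) ℕ.+ 4 ℕ.* (60 ℕ.* v) ≡ 60 ℕ.* (u ℕ.+ 4 ℕ.* v)
  stepW = ℕ-Ring.solve-∀
  descend : ∀ w →
    (∀ {w′} → w′ ℕ.< w → ∀ r → PellSolution r w′ → ∃[ n ] (r ≡ 4 ℕ.* pellU n × w′ ≡ 60 ℕ.* pellV n)) →
    ∀ r → PellSolution r w → ∃[ n ] (r ≡ 4 ℕ.* pellU n × w ≡ 60 ℕ.* pellV n)
  descend w rec r eq with r ℕ.<? 16
  ... | yes r<16 = 0 , small-solution r<16 w<60 eq
    where
    w<60 : w ℕ.< 60
    w<60 = s≤s (ℕ.≮⇒≥ λ 59<w → ℕ.<-irrefl refl (begin-strict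
      15 ℕ.* (r ℕ.* r)     ≤⟨ ℕ.*-monoʳ-≤ 15 (ℕ.*-mono-≤ (ℕ.≤-pred r<16) (ℕ.≤-pred r<16)) ⟩
      15 ℕ.* (15 ℕ.* 15)   <⟨ from-yes (15 ℕ.* (15 ℕ.* 15) ℕ.<? 60 ℕ.* 60) ⟩
      60 ℕ.* 60            ≤⟨ ℕ.*-mono-≤ 59<w 59<w ⟩
      w ℕ.* w              ≤⟨ ℕ.m≤m+n (w ℕ.* w) 240 ⟩
      w ℕ.* w ℕ.+ 240      ≡⟨ eq ⟩
      15 ℕ.* (r ℕ.* r)     ∎))
      where open ℕ.≤-Reasoning
  ... | no r≮16 =
    let r′ , w′ , r≡ , w≡ = predecessor r w (ℕ.≮⇒≥ r≮16) eq
        eq′ = PellSolution-step⁻¹ r′ w′ (subst₂ PellSolution r≡ w≡ eq)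
        n , r′≡ , w′≡ = rec (subst (w′ ℕ.<_) (sym w≡) (w<w′ r′ w′ eq′)) r′ eq′
        u = pellU n
        v = pellV n
    in suc n
     , trans r≡ (trans (cong₂ (λ x y → 4 ℕ.* x ℕ.+ y) r′≡ w′≡) (stepR u v))
     , trans w≡ (trans (cong₂ (λ x y → 15 ℕ.* x ℕ.+ 4 ℕ.* y) r′≡ w′≡) (stepW u v))

-- Heron's formula as an equation in natural numbers

heronProduct : ℤ → ℤ → ℤ → ℤ
heronProduct x y z = (x + y + z) * (- x + y + z) * (x - y + z) * (x + y - z)

-- Heron's formula for b = 4A, both sides moved so that no subtraction occurs.
AreaEquation : ℕ → ℕ → Set
AreaEquation r b = b ℕ.* b ℕ.+ 240 ℕ.* (r ℕ.* r) ≡ 15 ℕ.* (r ℕ.* r ℕ.* (r ℕ.* r))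

module _ (r b : ℕ) where
  private
    R = + r
    B = + b
    P = heronProduct R (+ 2 * R - + 2) (+ 2 * R + + 2)

    lhs : + (b ℕ.* b ℕ.+ 240 ℕ.* (r ℕ.* r)) ≡ B * B + + 240 * (R * R)
    lhs = trans (ℤ.pos-+ (b ℕ.* b) _) (cong₂ _+_ (ℤ.pos-* b b)
      (trans (ℤ.pos-* 240 (r ℕ.* r)) (cong (+ 240 *_) (ℤ.pos-* r r))))

    rhs : + (15 ℕ.* (r ℕ.* r ℕ.* (r ℕ.* r))) ≡ + 15 * (R * R * (R * R))
    rhs = trans (ℤ.pos-* 15 (r ℕ.* r ℕ.* (r ℕ.* r))) (cong (+ 15 *_)
      (trans (ℤ.pos-* (r ℕ.* r) (r ℕ.* r)) (cong₂ _*_ (ℤ.pos-* r r) (ℤ.pos-* r r))))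

    -- The four factors are 5x, 3x, x + 4 and x - 4, with product 15 x² (x² - 16).
    product : ∀ x →
      (x + (+ 2 * x - + 2) + (+ 2 * x + + 2)) * (- x + (+ 2 * x - + 2) + (+ 2 * x + + 2)) *
      (x - (+ 2 * x - + 2) + (+ 2 * x + + 2)) * (x + (+ 2 * x - + 2) - (+ 2 * x + + 2))
      + + 240 * (x * x) ≡ + 15 * (x * x * (x * x))
    product = ℤ-Ring.solve-∀

  heronProduct⇔AreaEquation : B * B ≡ P ⇔ AreaEquation r b
  heronProduct⇔AreaEquation = mk⇔
    (λ eq → ℤ.+-injective
      (trans lhs (trans (cong (_+ + 240 * (R * R)) eq) (trans (product R) (sym rhs)))))
    (λ eq → +-cancelʳ (+ 240 * (R * R)) _ _
      (trans (sym lhs) (trans (cong +_ eq) (trans rhs (sym (product R))))))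

-- r² divides both 15 r⁴ and 240 r², hence also b².
AreaEquation⇒∣ : ∀ r b .{{_ : ℕ.NonZero r}} → AreaEquation r b → r ∣ b
AreaEquation⇒∣ r b eq = m²∣n²⇒m∣n r b
  (∣m+n∣m⇒∣n {m = 240 ℕ.* (r ℕ.* r)} {n = b ℕ.* b} r²∣sum (n∣m*n 240 {r ℕ.* r}))
  where
  regroup : ∀ x → 15 ℕ.* (x ℕ.* x) ≡ (15 ℕ.* x) ℕ.* x
  regroup = ℕ-Ring.solve-∀
  r²∣sum : r ℕ.* r ∣ 240 ℕ.* (r ℕ.* r) ℕ.+ b ℕ.* b
  r²∣sum = divides (15 ℕ.* (r ℕ.* r))
    (trans (ℕ.+-comm (240 ℕ.* (r ℕ.* r)) (b ℕ.* b)) (trans eq (regroup (r ℕ.* r))))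

AreaEquation⇒PellSolution : ∀ r w .{{_ : ℕ.NonZero r}} → AreaEquation r (w ℕ.* r) → PellSolution r w
AreaEquation⇒PellSolution r w eq =
  ℕ.*-cancelˡ-≡ (w ℕ.* w ℕ.+ 240) (15 ℕ.* (r ℕ.* r)) (r ℕ.* r) {{ℕ.m*n≢0 r r}}
    (trans (expand w r) (trans eq (collect (r ℕ.* r))))
  where
  expand : ∀ w r → (r ℕ.* r) ℕ.* (w ℕ.* w ℕ.+ 240) ≡ (w ℕ.* r) ℕ.* (w ℕ.* r) ℕ.+ 240 ℕ.* (r ℕ.* r)
  expand = ℕ-Ring.solve-∀
  collect : ∀ x → 15 ℕ.* (x ℕ.* x) ≡ x ℕ.* (15 ℕ.* x)
  collect = ℕ-Ring.solve-∀

AreaEquation⇒pell : ∀ r b .{{_ : ℕ.NonZero r}} → AreaEquation r b → ∃[ n ] r ≡ 4 ℕ.* pellU n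
AreaEquation⇒pell r b eq =
  let r∣b = AreaEquation⇒∣ r b eq
      w = quotient r∣b
      n , r≡ , _ = PellSolution⇒pell w r
        (AreaEquation⇒PellSolution r w (subst (AreaEquation r) (_∣_.equality r∣b) eq))
  in n , r≡

-- With r = 4u and w = 60v, the area r w / 4 is 60uv, and the second argument is four times it.
AreaEquation-pell : ∀ n → AreaEquation (4 ℕ.* pellU n) (4 ℕ.* (60 ℕ.* (pellU n ℕ.* pellV n)))
AreaEquation-pell n = begin
  (4 ℕ.* (60 ℕ.* (u ℕ.* v))) ℕ.* (4 ℕ.* (60 ℕ.* (u ℕ.* v))) ℕ.+ 240 ℕ.* (4 ℕ.* u ℕ.* (4 ℕ.* u))
    ≡⟨ factor u v ⟩
  3840 ℕ.* (u ℕ.* u) ℕ.* (1 ℕ.+ 15 ℕ.* (v ℕ.* v))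
    -- The Pell equation turns the factor 1 + 15 v² into u².
    ≡⟨ cong (3840 ℕ.* (u ℕ.* u) ℕ.*_) (sym (pell-equation n)) ⟩
  3840 ℕ.* (u ℕ.* u) ℕ.* (u ℕ.* u)
    ≡⟨ collect u ⟩
  15 ℕ.* (4 ℕ.* u ℕ.* (4 ℕ.* u) ℕ.* (4 ℕ.* u ℕ.* (4 ℕ.* u))) ∎
  where
  open ≡-Reasoning
  u = pellU n
  v = pellV n
  factor : ∀ u v →
    (4 ℕ.* (60 ℕ.* (u ℕ.* v))) ℕ.* (4 ℕ.* (60 ℕ.* (u ℕ.* v))) ℕ.+ 240 ℕ.* (4 ℕ.* u ℕ.* (4 ℕ.* u)) ≡
    3840 ℕ.* (u ℕ.* u) ℕ.* (1 ℕ.+ 15 ℕ.* (v ℕ.* v))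
  factor = ℕ-Ring.solve-∀
  collect : ∀ u → 3840 ℕ.* (u ℕ.* u) ℕ.* (u ℕ.* u) ≡
    15 ℕ.* (4 ℕ.* u ℕ.* (4 ℕ.* u) ℕ.* (4 ℕ.* u ℕ.* (4 ℕ.* u)))
  collect = ℕ-Ring.solve-∀

-- The triple and its triangle

-- Splits a strict inequality into a ring identity that exhibits the gap `d` and a positivity check
-- on `d`.
x<x+d : ∀ {x y d} → + 0 < d → y ≡ x + d → x < y
x<x+d {x} {d = d} 0<d refl = subst (_< x + d) (ℤ.+-identityʳ x) (ℤ.+-monoʳ-< x 0<d)

isTriangle : ∀ r → + 5 ≤ r → IsTriangle r (+ 2 * r - + 2) (+ 2 * r + + 2)
-- Matching down to `z≤n` exposes r as 5 + k, so that sides and gaps evaluate to visibly positive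
-- integers.
isTriangle r (+≤+ (s≤s (s≤s (s≤s (s≤s (s≤s z≤n)))))) = record
  { x>0   = +<+ z<s
  ; y>0   = +<+ z<s
  ; z>0   = +<+ z<s
  ; x<y+z = x<x+d {d = + 3 * r} (+<+ z<s) (x-gap r)
  ; y<x+z = x<x+d {d = + 4 + r} (+<+ z<s) (y-gap r)
  -- The gap r - 4 is where r ≥ 5 is sharp: at r = 4 the sides 4, 6, 10 are degenerate.
  ; z<x+y = x<x+d {d = r - + 4} (+<+ z<s) (z-gap r)
  }
  where
  x-gap : ∀ r → (+ 2 * r - + 2) + (+ 2 * r + + 2) ≡ r + + 3 * r
  x-gap = ℤ-Ring.solve-∀
  y-gap : ∀ r → r + (+ 2 * r + + 2) ≡ (+ 2 * r - + 2) + (+ 4 + r)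
  y-gap = ℤ-Ring.solve-∀
  z-gap : ∀ r → r + (+ 2 * r - + 2) ≡ (+ 2 * r + + 2) + (r - + 4)
  z-gap = ℤ-Ring.solve-∀

associatedTriangle : ∀ r → + 5 ≤ r →
  AssociatedTriangle (r - + 2) (r + + 2) (+ 4 * r) r (+ 2 * r - + 2) (+ 2 * r + + 2)
associatedTriangle r 5≤r@(+≤+ (s≤s (s≤s (s≤s (s≤s (s≤s z≤n)))))) = record
  { triple   = record
    { a>0 = +<+ z<s
    ; b>0 = +<+ z<s
    ; c>0 = +<+ z<s
    ; a≢b = ℤ.<⇒≢ a<b
    ; a≢c = ℤ.<⇒≢ (ℤ.<-trans a<b b<c)
    ; b≢c = ℤ.<⇒≢ b<c
    ; ab  = r , ab≡ r
    ; ac  = + 2 * r - + 2 , ac≡ r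
    ; bc  = + 2 * r + + 2 , bc≡ r
    }
  ; a<b      = a<b
  ; b<c      = b<c
  ; x≡√      = +≤+ z≤n , sym (ab≡ r)
  ; y≡√      = +≤+ z≤n , sym (ac≡ r)
  ; z≡√      = +≤+ z≤n , sym (bc≡ r)
  ; triangle = isTriangle r 5≤r
  }
  where
  ab≡ : ∀ r → (r - + 2) * (r + + 2) + + 4 ≡ r * r
  ab≡ = ℤ-Ring.solve-∀
  ac≡ : ∀ r → (r - + 2) * (+ 4 * r) + + 4 ≡ (+ 2 * r - + 2) * (+ 2 * r - + 2)
  ac≡ = ℤ-Ring.solve-∀
  bc≡ : ∀ r → (r + + 2) * (+ 4 * r) + + 4 ≡ (+ 2 * r + + 2) * (+ 2 * r + + 2)
  bc≡ = ℤ-Ring.solve-∀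
  ab-gap : ∀ r → r + + 2 ≡ (r - + 2) + + 4
  ab-gap = ℤ-Ring.solve-∀
  bc-gap : ∀ r → + 4 * r ≡ (r + + 2) + (+ 3 * r - + 2)
  bc-gap = ℤ-Ring.solve-∀
  a<b : r - + 2 < r + + 2
  a<b = x<x+d {d = + 4} (+<+ z<s) (ab-gap r)
  b<c : r + + 2 < + 4 * r
  b<c = x<x+d {d = + 3 * r - + 2} (+<+ z<s) (bc-gap r)

-- The two directions of the equivalence

pell-index≥1 : ∀ {r} → 5 ℕ.≤ r → ∃[ n ] r ≡ 4 ℕ.* pellU n → ∃[ n ] (1 ℕ.≤ n × + r ≡ rSeq n)
-- Index 0 gives r = 4, which 5 ≤ r excludes.
pell-index≥1 5≤r (zero  , r≡4) = contradiction (subst (5 ℕ.≤_) r≡4 5≤r) (ℕ.<⇒≱ (ℕ.n<1+n 4))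
pell-index≥1 5≤r (suc n , r≡)  = suc n , s≤s z≤n , trans (cong +_ r≡) (sym (rSeq≡4pellU (suc n)))

heronian⇒rSeq : ∀ r → + 5 ≤ r →
  IsHeronian r (+ 2 * r - + 2) (+ 2 * r + + 2) → ∃[ n ] (1 ℕ.≤ n × r ≡ rSeq n)
heronian⇒rSeq (+ r) (+≤+ 5≤r) (_ , A , 0≤4A , area) = pell-index≥1 5≤r
  (AreaEquation⇒pell r b {{ℕ.>-nonZero (ℕ.≤-trans (s≤s z≤n) 5≤r)}}
    (Equivalence.to (heronProduct⇔AreaEquation r b) +b²≡))
  where
  -- As 0 ≤ 4A, this natural number is 4A itself.
  b = ∣ + 4 * A ∣
  +b²≡ : + b * + b ≡ heronProduct (+ r) (+ 2 * + r - + 2) (+ 2 * + r + + 2)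
  +b²≡ = trans (cong₂ _*_ (ℤ.0≤i⇒+∣i∣≡i 0≤4A) (ℤ.0≤i⇒+∣i∣≡i 0≤4A)) area

AreaEquation⇒hasArea : ∀ r a → AreaEquation r (4 ℕ.* a) →
  HasArea (+ r) (+ 2 * + r - + 2) (+ 2 * + r + + 2) (+ a)
AreaEquation⇒hasArea r a eq =
  subst (λ s → IsSqrt s (heronProduct (+ r) (+ 2 * + r - + 2) (+ 2 * + r + + 2))) (ℤ.pos-* 4 a)
    (+≤+ z≤n , Equivalence.from (heronProduct⇔AreaEquation r (4 ℕ.* a)) eq)

rSeq⇒hasArea : ∀ n → ∃[ A ] HasArea (rSeq n) (+ 2 * rSeq n - + 2) (+ 2 * rSeq n + + 2) A
rSeq⇒hasArea n = + a ,
  subst (λ r → HasArea r (+ 2 * r - + 2) (+ 2 * r + + 2) (+ a)) (sym (rSeq≡4pellU n))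
    (AreaEquation⇒hasArea (4 ℕ.* pellU n) a (AreaEquation-pell n))
  where a = 60 ℕ.* (pellU n ℕ.* pellV n)

proposition4p6 : (r : ℤ) → + 5 ≤ r →
    AssociatedTriangle (r - + 2) (r + + 2) (+ 4 * r) r (+ 2 * r - + 2) (+ 2 * r + + 2)
    × (IsHeronian r (+ 2 * r - + 2) (+ 2 * r + + 2) ⇔ (∃[ n ] (1 ℕ.≤ n × r ≡ rSeq n)))
proposition4p6 r 5≤r = associatedTriangle r 5≤r ,
  mk⇔ (heronian⇒rSeq r 5≤r) λ { (n , _ , refl) → isTriangle r 5≤r , rSeq⇒hasArea n }
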